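{- Let $a\ge 2$, $c>0$, $d$ be integers with $d<ca$ and $\gcd(d,a)=\gcd(d,c)=1$, let $n\ge 1$, and let $\mathbf s_j=ca^{n+j}-d$ for $j\in\mathbb N$ and $S_n=\langle\{\mathbf s_j:j\in\mathbb N\}\rangle$. Let $\lambda=\gcd(S_n)$. Let $m$ be the smallest positive integer such that $\mathbf s_0/\lambda\le \mathbf R_m$, and assume that $\mathbf s_1/\lambda\ge \mathbf R_m$. Then $e(S_n)=m$.
   Context: $\mathbb N=\{0,1,2,\ldots\}$. For $A\subseteq\mathbb N$, $\langle A\rangle$ is the submonoid of $(\mathbb N,+)$ generated by $A$. For a nontrivial submonoid $M$ of $\mathbb N$, the minimal generating set of $M$ is the unique generating set contained in every generating set of $M$ (its elements are the nonzero elements of $M$ that are not sums of two nonzero elements of $M$; it is finite), and $e(M)$ is its cardinality. $\gcd(M)$ denotes the greatest common divisor of all elements of $M$. The repunit numbers in base $a$ are $\mathbf R_0=0$ and $\mathbf R_k=1+a+\cdots+a^{k-1}=(a^k-1)/(a-1)$ for $k\ge 1$. -}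

module Defs where

open import Data.Integer as ℤ using (ℤ; +_)
open import Data.List using (List; length)
open import Data.List.Membership.Propositional using (_∈_)
open import Data.List.Relation.Unary.Unique.Propositional using (Unique)
open import Data.Nat using (ℕ; zero; suc; _+_; _*_; _^_; _≤_)
open import Data.Nat.Divisibility using (_∣_)
open import Data.Product using (∃-syntax; _×_)
open import Level using (0ℓ) renaming (suc to lsuc)
open import Relation.Binary.PropositionalEquality using (_≡_)
open import Relation.Unary using (Pred; _⊆_; _≐_)

data ⟨_⟩ (A : Pred ℕ 0ℓ) : Pred ℕ 0ℓ where
  gen  : ∀ {x} → A x → ⟨ A ⟩ x
  zero : ⟨ A ⟩ 0
  add  : ∀ {x y} → ⟨ A ⟩ x → ⟨ A ⟩ y → ⟨ A ⟩ (x + y)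

Generates : Pred ℕ 0ℓ → Pred ℕ 0ℓ → Set
Generates A M = ⟨ A ⟩ ≐ M

IsMinimalGeneratingSet : Pred ℕ 0ℓ → Pred ℕ 0ℓ → Set (lsuc 0ℓ)
IsMinimalGeneratingSet A M =
  Generates A M × (∀ (B : Pred ℕ 0ℓ) → Generates B M → A ⊆ B)

HasCardinality : Pred ℕ 0ℓ → ℕ → Set
HasCardinality A k =
  ∃[ xs ] Unique xs × A ≐ (_∈ xs) × length xs ≡ k

-- HasEmbeddingDimension M k is the relational form of e(M) = k: the minimal
-- generating set is unique up to ≐, so there is at most one such k.
HasEmbeddingDimension : Pred ℕ 0ℓ → ℕ → Set (lsuc 0ℓ)
HasEmbeddingDimension M k =
  ∃[ A ] IsMinimalGeneratingSet A M × HasCardinality A k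

-- IsGCD M g is the relational form of gcd(M) = g, for a possibly infinite M.
record IsGCD (M : Pred ℕ 0ℓ) (g : ℕ) : Set where
  field
    divides  : ∀ {x} → M x → g ∣ x
    greatest : ∀ {h} → (∀ {x} → M x → h ∣ x) → h ∣ g

IsLeast : Pred ℕ 0ℓ → ℕ → Set
IsLeast P m = P m × (∀ {k} → P k → m ≤ k)

repunit : ℕ → ℕ → ℕ
repunit a zero    = 0
repunit a (suc k) = repunit a k + a ^ k

s : (a c : ℕ) (d : ℤ) (n j : ℕ) → ℤ
s a c d n j = + (c * a ^ (n + j)) ℤ.- d

-- Every s a c d n j is positive when d < c a and n ≥ 1, so restricting to
-- natural numbers loses no generator.
S : (a c : ℕ) (d : ℤ) (n : ℕ) → Pred ℕ 0ℓ
S a c d n = ⟨ (λ x → ∃[ j ] + x ≡ s a c d n j) ⟩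

{-# OPTIONS --safe #-}

-- Put T = c aⁿ (a − 1). Then s_j = s_0 + T R_j, so g = gcd(s_0 , T), and
-- s_j = (σ + τ R_j) g with σ and τ coprime.
--
-- An element of S_n that is a sum of N generators has the form (N σ + τ r) g.
-- If s_k is a sum of two nonzero elements, then N ≥ 2 and
-- (N − 1) σ = τ (R_k − r), so σ divides the positive number R_k − r. Hence
-- σ ≤ R_k and m ≤ k: the generators s_k with k < m are irreducible.
--
-- Conversely, write R_m = σ + ρ and τ = κ + ρ. Since R_{m+i} = R_i + aⁱ R_m,
-- we get s_{m+i} = s_i + aⁱ (κ s_0 + ρ s_1), so by induction the first m
-- generators suffice; when m = 1, s_1 does not occur because ρ = 0.
module Submission where

open import Defs
open import Data.Empty using (⊥-elim)
open import Data.Integer as ℤ using (ℤ; +_)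
import Data.Integer.DivMod as ℤ
import Data.Integer.Properties as ℤ
open import Data.Integer.GCD using (gcd)
open import Data.List.Base using (applyUpTo)
open import Data.List.Membership.Propositional using (_∈_)
open import Data.List.Membership.Propositional.Properties
  using (∈-applyUpTo⁺; ∈-applyUpTo⁻)
open import Data.List.Properties using (length-applyUpTo)
open import Data.List.Relation.Unary.Unique.Propositional.Properties
  using (applyUpTo⁺₁)
open import Data.Nat
open import Data.Nat.Coprimality using (Coprime; coprime-divisor)
open import Data.Nat.Divisibility
open import Data.Nat.DivMod using (m*n/n≡m)
open import Data.Nat.Induction using (<-rec)
open import Data.Nat.Properties
open import Data.Nat.Tactic.RingSolver using (solve-∀)
open import Data.Product using (_×_; _,_; ∃-syntax; proj₂)
open import Data.Sum using (_⊎_; inj₁; inj₂)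
open import Level using (0ℓ)
open import Relation.Binary.PropositionalEquality
open import Relation.Nullary using (yes; no)
open import Relation.Unary using (Pred; _⊆_; _≐_)

-- Generated submonoids and their irreducible elements.

module _ {A : Pred ℕ 0ℓ} where

  multiple : ∀ k {x} → ⟨ A ⟩ x → ⟨ A ⟩ (k * x)
  multiple zero    p = zero
  multiple (suc k) p = add p (multiple k p)

  ⟨⟩-least : ∀ {B} → A ⊆ ⟨ B ⟩ → ⟨ A ⟩ ⊆ ⟨ B ⟩
  ⟨⟩-least A⊆B (gen p)   = A⊆B p
  ⟨⟩-least A⊆B zero      = zero
  ⟨⟩-least A⊆B (add p q) = add (⟨⟩-least A⊆B p) (⟨⟩-least A⊆B q)

  ∣-⟨⟩ : ∀ {h} → (∀ {x} → A x → h ∣ x) → ∀ {x} → ⟨ A ⟩ x → h ∣ x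
  ∣-⟨⟩ h∣A (gen p)   = h∣A p
  ∣-⟨⟩ h∣A zero      = _ ∣0
  ∣-⟨⟩ h∣A (add p q) = ∣m∣n⇒∣m+n (∣-⟨⟩ h∣A p) (∣-⟨⟩ h∣A q)

Irreducible : Pred ℕ 0ℓ → Pred ℕ 0ℓ
Irreducible M z = z ≢ 0 × (∀ {x y} → M x → M y → x + y ≡ z → x ≡ 0 ⊎ y ≡ 0)

-- Induction on the derivation: a sum equal to an irreducible element has a zero summand, and the
-- other summand is that same element with a shorter derivation.
irreducible⇒generator : ∀ {B z} → Irreducible ⟨ B ⟩ z → ⟨ B ⟩ z → B z
irreducible⇒generator irr       (gen p) = p
irreducible⇒generator (z≢0 , _) zero    = ⊥-elim (z≢0 refl)
irreducible⇒generator {B} irr   (add {x} {y} p q) with proj₂ irr p q refl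
... | inj₁ refl = irreducible⇒generator irr q
... | inj₂ refl = subst B (sym (+-identityʳ x))
  (irreducible⇒generator (subst (Irreducible ⟨ B ⟩) (+-identityʳ x) irr) p)

-- Irreducibility refers only to `M`, so it passes to `⟨ B ⟩` for every generating `B` and there
-- forces membership in `B`.
irreducibles-minimal : ∀ {A M} → Generates A M → A ⊆ Irreducible M →
                       IsMinimalGeneratingSet A M
irreducibles-minimal {M = M} (⟨A⟩⊆M , M⊆⟨A⟩) irr =
  (⟨A⟩⊆M , M⊆⟨A⟩) , λ B (⟨B⟩⊆M , M⊆⟨B⟩) Az →
    let z≢0 , split = irr Az in
    irreducible⇒generator
      (z≢0 , λ p q → split (⟨B⟩⊆M p) (⟨B⟩⊆M q))
      (M⊆⟨B⟩ (⟨A⟩⊆M (gen Az)))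

-- Monotone sequences and repunit identities.

increasing⇒< : ∀ {f : ℕ → ℕ} → (∀ k → f k < f (suc k)) →
               ∀ {i j} → i < j → f i < f j
increasing⇒< {f} inc i<j = go (≤⇒≤′ i<j)
  where
  go : ∀ {i j} → suc i ≤′ j → f i < f j
  go ≤′-refl       = inc _
  go (≤′-step i<j) = <-trans (go i<j) (inc _)

-- Of the first m + i powers of `a`, the lowest i sum to `repunit a i`; the other m share the factor
-- `a ^ i`.
repunit-+ : ∀ a m i → repunit a (m + i) ≡ repunit a i + a ^ i * repunit a m
repunit-+ a zero    i = sym (trans (cong (λ e → repunit a i + e) (*-zeroʳ (a ^ i)))
                                   (+-identityʳ _))
repunit-+ a (suc m) i = begin
  repunit a (m + i) + a ^ (m + i)
    ≡⟨ cong₂ _+_ (repunit-+ a m i) (^-distribˡ-+-* a m i) ⟩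
  repunit a i + a ^ i * repunit a m + a ^ m * a ^ i
    ≡⟨ regroup (repunit a i) (a ^ i) (repunit a m) (a ^ m) ⟩
  repunit a i + a ^ i * (repunit a m + a ^ m) ∎
  where
  open ≡-Reasoning
  regroup : ∀ r p q e → r + p * q + e * p ≡ r + p * (q + e)
  regroup = solve-∀

repunit-increasing : ∀ a .{{_ : NonZero a}} k → repunit a k < repunit a (suc k)
repunit-increasing a k = m<m+n (repunit a k) (m^n>0 a k)

-- The closed form (a^k - 1)/(a - 1) with the division cleared; writing a as `suc b` avoids
-- subtraction.
^-repunit : ∀ b k → suc b ^ k ≡ 1 + b * repunit (suc b) k
^-repunit b zero    = cong suc (sym (*-zeroʳ b))
^-repunit b (suc k) = begin
  suc b ^ k + b * suc b ^ k              ≡⟨ cong (_+ b * suc b ^ k) (^-repunit b k) ⟩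
  1 + b * R + b * suc b ^ k              ≡⟨ regroup b R (suc b ^ k) ⟩
  1 + b * (R + suc b ^ k)                ∎
  where
  open ≡-Reasoning
  R = repunit (suc b) k
  regroup : ∀ b r p → 1 + b * r + b * p ≡ 1 + b * (r + p)
  regroup = solve-∀

-- The monoid generated by an affine image of the repunits.

module AffineRepunits
  (a σ τ g : ℕ) .{{_ : NonZero a}} .{{_ : NonZero σ}} .{{_ : NonZero τ}}
  .{{_ : NonZero g}} (σ⊥τ : Coprime σ τ)
  (G : Pred ℕ 0ℓ)
  where

  R t : ℕ → ℕ
  R = repunit a
  t j = (σ + τ * R j) * g

  t-increasing : ∀ k → t k < t (suc k)
  t-increasing k = *-monoˡ-< g (+-monoʳ-< σ (*-monoʳ-< τ (repunit-increasing a k)))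

  t≢0 : ∀ k → t k ≢ 0
  t≢0 k tk≡0 = ≢-nonZero⁻¹ σ (m+n≡0⇒m≡0 σ (m*n≡0⇒m≡0 _ g tk≡0))

  First : ℕ → Pred ℕ 0ℓ
  First m x = ∃[ j ] j < m × x ≡ t j

  -- The two equations give κ t_0 + ρ t_1 = ((κ + ρ) σ + ρ τ) g = τ (σ + ρ) g = τ R_m g. Scaled by
  -- a^i, this is the increment from t_i to t_{m+i} supplied by `repunit-+`.
  t-shift : ∀ {m κ ρ} → σ + ρ ≡ R m → κ + ρ ≡ τ → ∀ i →
            t i + a ^ i * (κ * t 0 + ρ * t 1) ≡ t (m + i)
  t-shift {m} {κ} {ρ} σ+ρ κ+ρ i = begin
    t i + a ^ i * (κ * t 0 + ρ * t 1)
      ≡⟨ cong (λ y → t i + a ^ i * y) base ⟩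
    t i + a ^ i * (τ * R m * g)
      ≡⟨ regroup σ τ g (R i) (a ^ i) (R m) ⟩
    (σ + τ * (R i + a ^ i * R m)) * g
      ≡⟨ cong (λ r → (σ + τ * r) * g) (repunit-+ a m i) ⟨
    t (m + i) ∎
    where
    open ≡-Reasoning
    regroup : ∀ s t g r p q →
              (s + t * r) * g + p * (t * q * g) ≡ (s + t * (r + p * q)) * g
    regroup = solve-∀
    -- The literals 0 and 1 are the values of `R 0` and `R 1`; `k + r` and `s + r` stand for τ and
    -- R_m, which `base` substitutes.
    expand : ∀ s k r g → k * ((s + (k + r) * 0) * g) + r * ((s + (k + r) * 1) * g)
             ≡ (k + r) * (s + r) * g
    expand = solve-∀
    base : κ * t 0 + ρ * t 1 ≡ τ * R m * g
    base = subst₂ (λ u v → κ * ((σ + u * 0) * g) + ρ * ((σ + u * 1) * g) ≡ u * v * g)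
                  κ+ρ σ+ρ (expand σ κ ρ g)

  first-spans : ∀ {m} → 0 < m → σ ≤ R m → R m ≤ σ + τ → ∀ j → ⟨ First m ⟩ (t j)
  first-spans {m} 0<m σ≤Rm Rm≤σ+τ with m≤n⇒∃[o]m+o≡n σ≤Rm
  ... | ρ , σ+ρ≡Rm = <-rec _ step
    where
    -- The upper bound on `R m` enters here: it makes `τ ∸ ρ` an exact difference, the κ of
    -- `t-shift`.
    ρ≤τ : ρ ≤ τ
    ρ≤τ = +-cancelˡ-≤ σ ρ τ (≤-trans (≤-reflexive σ+ρ≡Rm) Rm≤σ+τ)

    ρt₁ : ∀ {m} → 0 < m → σ + ρ ≡ R m → ⟨ First m ⟩ (ρ * t 1)
    ρt₁ {suc zero} _ σ+ρ≡1 = subst (λ r → ⟨ First 1 ⟩ (r * t 1)) (sym ρ≡0) zero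
      where
      ρ≡0 : ρ ≡ 0
      ρ≡0 = n≤0⇒n≡0 (+-cancelˡ-≤ 1 ρ 0
              (≤-trans (+-monoˡ-≤ ρ (>-nonZero⁻¹ σ)) (≤-reflexive σ+ρ≡1)))
    ρt₁ {suc (suc m)} _ _ = multiple ρ (gen (1 , s≤s (s≤s z≤n) , refl))

    step : ∀ j → (∀ {i} → i < j → ⟨ First m ⟩ (t i)) → ⟨ First m ⟩ (t j)
    step j rec with j <? m
    ... | yes j<m = gen (j , j<m , refl)
    ... | no  j≮m with m≤n⇒∃[o]m+o≡n (≮⇒≥ j≮m)
    ...   | i , refl =
      -- Only `t i` needs the induction hypothesis, and i < m + i because m is positive.
      subst ⟨ First m ⟩ (t-shift {m} {τ ∸ ρ} σ+ρ≡Rm (m∸n+n≡m ρ≤τ) i)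
        (add (rec (m<n+m i 0<m))
             (multiple (a ^ i)
               (add (multiple (τ ∸ ρ) (gen (0 , 0<m , refl))) (ρt₁ 0<m σ+ρ≡Rm))))

  -- N counts the generators in a sum and r adds up their repunits.
  record Combination (x : ℕ) : Set where
    constructor combination
    field
      N r   : ℕ
      value : x ≡ (N * σ + τ * r) * g
      empty : N ≡ 0 → x ≡ 0

  combinations : G ⊆ (λ x → ∃[ j ] x ≡ t j) → ⟨ G ⟩ ⊆ Combination
  combinations G⊆t (gen p) with G⊆t p
  ... | j , refl = combination 1 (R j)
                     (cong (λ u → (u + τ * R j) * g) (sym (+-identityʳ σ))) λ ()
  combinations G⊆t zero = combination 0 0 (cong (_* g) (sym (*-zeroʳ τ))) λ _ → refl
  combinations G⊆t (add p q) with combinations G⊆t p | combinations G⊆t q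
  ... | combination N r v e | combination N′ r′ v′ e′ =
    combination (N + N′) (r + r′)
      (trans (cong₂ _+_ v v′) (regroup σ τ g N r N′ r′))
      λ N+N′≡0 → cong₂ _+_ (e (m+n≡0⇒m≡0 N N+N′≡0)) (e′ (m+n≡0⇒n≡0 N N+N′≡0))
    where
    regroup : ∀ s t g n r n′ r′ →
              (n * s + t * r) * g + (n′ * s + t * r′) * g
              ≡ ((n + n′) * s + t * (r + r′)) * g
    regroup = solve-∀

  -- Cancelling one σ leaves the positive multiple `suc N * σ`. Positivity makes `R k ∸ r` nonzero,
  -- without which divisibility by σ would give no bound.
  several⇒σ≤R : ∀ {N r k} → (2 + N) * σ + τ * r ≡ σ + τ * R k → σ ≤ R k
  several⇒σ≤R {N} {r} {k} eq = ≤-trans (∣⇒≤ {{>-nonZero (m<n⇒0<n∸m r<Rk)}} σ∣) (m∸n≤m (R k) r)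
    where
    excess : suc N * σ + τ * r ≡ τ * R k
    excess = +-cancelˡ-≡ σ _ _ (trans (sym (+-assoc σ (suc N * σ) (τ * r))) eq)

    r<Rk : r < R k
    r<Rk = *-cancelˡ-< τ r (R k) (subst (τ * r <_) excess
             (m<n+m (τ * r) (>-nonZero⁻¹ (suc N * σ) {{m*n≢0 (suc N) σ}})))

    σ∣ : σ ∣ R k ∸ r
    σ∣ = coprime-divisor σ⊥τ (divides (suc N) (begin
      τ * (R k ∸ r)                 ≡⟨ *-distribˡ-∸ τ (R k) r ⟩
      τ * R k ∸ τ * r               ≡⟨ cong (_∸ τ * r) excess ⟨
      suc N * σ + τ * r ∸ τ * r     ≡⟨ m+n∸n≡m (suc N * σ) (τ * r) ⟩
      suc N * σ                     ∎))
      where open ≡-Reasoning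

  σ≤R⇒0< : ∀ k → σ ≤ R k → 0 < k
  σ≤R⇒0< zero    σ≤0 = ⊥-elim (≢-nonZero⁻¹ σ (n≤0⇒n≡0 σ≤0))
  σ≤R⇒0< (suc _) _   = z<s

  first-irreducible : ∀ {m} → G ⊆ (λ x → ∃[ j ] x ≡ t j) →
                      (∀ {k} → 0 < k → σ ≤ R k → m ≤ k) →
                      First m ⊆ Irreducible ⟨ G ⟩
  first-irreducible {m} G⊆t least (k , k<m , refl) = t≢0 k , split
    where
    split : ∀ {x y} → ⟨ G ⟩ x → ⟨ G ⟩ y → x + y ≡ t k → x ≡ 0 ⊎ y ≡ 0
    split p q x+y≡tk with combinations G⊆t p | combinations G⊆t q
    -- `value` alone would allow N = 0 with r positive; `empty` is what makes such a summand vanish.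
    ... | combination zero r v e | _ = inj₁ (e refl)
    ... | combination (suc _) r v e | combination zero r′ v′ e′ = inj₂ (e′ refl)
    ... | combination (suc N) r v e | combination (suc N′) r′ v′ e′ =
      ⊥-elim (<⇒≱ k<m (least (σ≤R⇒0< k σ≤Rk) σ≤Rk))
      where
      regroup : ∀ s t g n r n′ r′ →
                (2 + (n + n′)) * s * g + t * (r + r′) * g
                ≡ ((1 + n) * s + t * r) * g + ((1 + n′) * s + t * r′) * g
      regroup = solve-∀
      σ≤Rk : σ ≤ R k
      σ≤Rk = several⇒σ≤R {N + N′} {r + r′} {k} (*-cancelʳ-≡ _ _ g (begin
        ((2 + (N + N′)) * σ + τ * (r + r′)) * g
          ≡⟨ *-distribʳ-+ g ((2 + (N + N′)) * σ) (τ * (r + r′)) ⟩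
        (2 + (N + N′)) * σ * g + τ * (r + r′) * g
          ≡⟨ regroup σ τ g N r N′ r′ ⟩
        (suc N * σ + τ * r) * g + (suc N′ * σ + τ * r′) * g
          ≡⟨ cong₂ _+_ v v′ ⟨
        _ ≡⟨ x+y≡tk ⟩
        t k ∎))
        where open ≡-Reasoning

  -- Knowing `G` only up to `≐` lets generators specified by integer equations be used directly.
  embeddingDimension : G ≐ (λ x → ∃[ j ] x ≡ t j) → ∀ {m} →
                       IsLeast (λ k → 0 < k × σ ≤ R k) m → R m ≤ σ + τ →
                       HasEmbeddingDimension ⟨ G ⟩ m
  embeddingDimension (G⊆t , t⊆G) {m} ((0<m , σ≤Rm) , least) Rm≤σ+τ =
    First m ,
    irreducibles-minimal
      ( ⟨⟩-least (λ (j , _ , x≡tj) → gen (t⊆G (j , x≡tj)))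
      , ⟨⟩-least (λ p → let j , x≡tj = G⊆t p in
          subst ⟨ First m ⟩ (sym x≡tj) (first-spans 0<m σ≤Rm Rm≤σ+τ j)))
      (first-irreducible G⊆t λ 0<k σ≤Rk → least (0<k , σ≤Rk)) ,
    applyUpTo t m ,
    applyUpTo⁺₁ t m (λ i<j _ → <⇒≢ (increasing⇒< t-increasing i<j)) ,
    ( (λ (j , j<m , x≡tj) → subst (_∈ applyUpTo t m) (sym x≡tj) (∈-applyUpTo⁺ t j<m))
    , ∈-applyUpTo⁻ t) ,
    length-applyUpTo t m

-- The sequence s_j in terms of repunits.

s-affine : ∀ b c d n j →
  s (suc b) c d n j ≡ s (suc b) c d n 0 ℤ.+ + (c * suc b ^ n * b * repunit (suc b) j)
s-affine b c d n j = begin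
  + (c * a ^ (n + j)) ℤ.- d           ≡⟨ cong (λ v → + v ℤ.- d) expand ⟩
  + (u + T) ℤ.- d                     ≡⟨ cong (ℤ._- d) (ℤ.pos-+ u T) ⟩
  + u ℤ.+ + T ℤ.- d                   ≡⟨ ℤ.+-assoc (+ u) (+ T) (ℤ.- d) ⟩
  + u ℤ.+ (+ T ℤ.- d)                 ≡⟨ cong (λ v → + u ℤ.+ v) (ℤ.+-comm (+ T) (ℤ.- d)) ⟩
  + u ℤ.+ (ℤ.- d ℤ.+ + T)             ≡⟨ ℤ.+-assoc (+ u) (ℤ.- d) (+ T) ⟨
  + u ℤ.- d ℤ.+ + T                   ∎
  where
  open ≡-Reasoning
  a = suc b
  u = c * a ^ (n + 0)
  T = c * a ^ n * b * repunit a j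
  regroup : ∀ c p b r → c * (p * (1 + b * r)) ≡ c * p + c * p * b * r
  regroup = solve-∀
  -- Substituting a^j = 1 + b R_j splits off the term for j = 0. The summand -d stays in ℤ, since d
  -- may have either sign.
  expand : c * a ^ (n + j) ≡ u + T
  expand = begin
    c * a ^ (n + j)                   ≡⟨ cong (c *_) (^-distribˡ-+-* a n j) ⟩
    c * (a ^ n * a ^ j)               ≡⟨ cong (λ v → c * (a ^ n * v)) (^-repunit b j) ⟩
    c * (a ^ n * (1 + b * repunit a j)) ≡⟨ regroup c (a ^ n) b (repunit a j) ⟩
    c * a ^ n + T                     ≡⟨ cong (λ e → c * a ^ e + T) (+-identityʳ n) ⟨
    u + T                             ∎

positive-difference : ∀ {d x} → d ℤ.< + x → ∃[ y ] 0 < y × + x ℤ.- d ≡ + y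
positive-difference {d} {x} d<x = go (+ x ℤ.- d) (subst (ℤ._< + x ℤ.- d)
                                     (ℤ.+-inverseʳ d) (ℤ.+-monoˡ-< (ℤ.- d) d<x))
  where
  go : ∀ i → + 0 ℤ.< i → ∃[ y ] 0 < y × i ≡ + y
  go _ (ℤ.+<+ 0<y) = _ , 0<y , refl

+/+ : ∀ x g .{{_ : NonZero g}} → + (x * g) ℤ./ + g ≡ + x
+/+ x g = trans (ℤ.div-pos-is-/ℕ (+ (x * g)) g) (cong +_ (m*n/n≡m x g))

-- From n ≥ 1 follows d < ca ≤ ca^n, so t₀ is positive; b = a - 1 > 0 makes T positive. Hence the
-- sequence can be handled in ℕ.
s-progression : ∀ a c d n → 2 ≤ a → 0 < c → d ℤ.< + (c * a) → 1 ≤ n →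
  ∃[ t₀ ] ∃[ T ] 0 < t₀ × 0 < T × (∀ j → s a c d n j ≡ + (t₀ + T * repunit a j))
s-progression a@(suc b) c d n (s≤s 0<b) 0<c d<ca 1≤n with positive-difference d<can
  where
  ca≤can : c * a ≤ c * a ^ (n + 0)
  ca≤can = *-monoʳ-≤ c (subst₂ _≤_ (^-identityʳ a) (cong (a ^_) (sym (+-identityʳ n)))
                                   (^-monoʳ-≤ a 1≤n))
  d<can : d ℤ.< + (c * a ^ (n + 0))
  d<can = ℤ.<-≤-trans d<ca (ℤ.+≤+ ca≤can)
... | t₀ , 0<t₀ , s₀≡t₀ =
  t₀ , c * a ^ n * b , 0<t₀ , *-mono-≤ (*-mono-≤ 0<c (m^n>0 a n)) 0<b , λ j →
  trans (s-affine b c d n j)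
    (trans (cong (ℤ._+ + (c * a ^ n * b * repunit a j)) s₀≡t₀) (sym (ℤ.pos-+ t₀ _)))

-- Division by the gcd.

theorem3p8 : (a c : ℕ) (d : ℤ) → 2 ≤ a → 0 < c → d ℤ.< + (c * a) →
    gcd d (+ a) ≡ + 1 → gcd d (+ c) ≡ + 1 →
    (n : ℕ) → 1 ≤ n →
    (g : ℕ) .{{_ : NonZero g}} → IsGCD (S a c d n) g →
    (m : ℕ) →
    IsLeast (λ k → 0 < k × s a c d n 0 ℤ./ + g ℤ.≤ + repunit a k) m →
    + repunit a m ℤ.≤ s a c d n 1 ℤ./ + g →
    HasEmbeddingDimension (S a c d n) m
theorem3p8 a c d 2≤a 0<c d<ca _ _ n 1≤n g isGCD m ((0<m , s₀≤Rm) , least) Rm≤s₁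
  with s-progression a c d n 2≤a 0<c d<ca 1≤n
... | t₀ , T , 0<t₀ , 0<T , s≡ with g∣t₀ | g∣T
  where
  -- The cases j = 0 and j = 1, with repunits 0 and 1, yield divisibility of t₀ and then of T.
  g∣s : ∀ j → g ∣ t₀ + T * repunit a j
  g∣s j = IsGCD.divides isGCD (gen (j , sym (s≡ j)))
  g∣t₀ : g ∣ t₀
  g∣t₀ = subst (g ∣_) (trans (cong (λ e → t₀ + e) (*-zeroʳ T)) (+-identityʳ t₀)) (g∣s 0)
  g∣T : g ∣ T
  g∣T = subst (g ∣_) (*-identityʳ T) (∣m+n∣m⇒∣n (g∣s 1) g∣t₀)
... | divides σ refl | divides τ refl =
  AffineRepunits.embeddingDimension a σ τ g
    {{>-nonZero (<-trans z<s 2≤a)}}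
    {{m*n≢0⇒m≢0 σ {{>-nonZero 0<t₀}}}}
    {{m*n≢0⇒m≢0 τ {{>-nonZero 0<T}}}}
    σ⊥τ _
    ( (λ (j , x≡sj) → j , ℤ.+-injective (trans x≡sj (s≡t j)))
    , (λ (j , x≡tj) → j , trans (cong +_ x≡tj) (sym (s≡t j))))
    -- Since s_0/g = σ and s_1/g = σ + τ exactly, the integer conditions on m become inequalities in
    -- ℕ.
    ( (0<m , σ≤ s₀≤Rm)
    , λ (0<k , σ≤Rk) → least (0<k , ℤ.≤-trans (ℤ.≤-reflexive s₀/g) (ℤ.+≤+ σ≤Rk)))
    (ℤ.drop‿+≤+ (ℤ.≤-trans Rm≤s₁ (ℤ.≤-reflexive s₁/g)))
  where
  s≡t : ∀ j → s a c d n j ≡ + ((σ + τ * repunit a j) * g)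
  s≡t j = trans (s≡ j) (cong +_ (regroup σ τ g (repunit a j)))
    where
    regroup : ∀ s t g r → s * g + t * g * r ≡ (s + t * r) * g
    regroup = solve-∀

  s/g : ∀ j → s a c d n j ℤ./ + g ≡ + (σ + τ * repunit a j)
  s/g j = trans (cong (ℤ._/ + g) (s≡t j)) (+/+ _ g)

  s₀/g : s a c d n 0 ℤ./ + g ≡ + σ
  s₀/g = trans (s/g 0) (cong +_ (trans (cong (λ e → σ + e) (*-zeroʳ τ)) (+-identityʳ σ)))

  s₁/g : s a c d n 1 ℤ./ + g ≡ + (σ + τ)
  s₁/g = trans (s/g 1) (cong (λ e → + (σ + e)) (*-identityʳ τ))

  σ≤ : ∀ {k} → s a c d n 0 ℤ./ + g ℤ.≤ + k → σ ≤ k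
  σ≤ p = ℤ.drop‿+≤+ (ℤ.≤-trans (ℤ.≤-reflexive (sym s₀/g)) p)

  -- If i divides σ and τ, then `i * g` divides every generator, hence all of S_n, hence g itself;
  -- so i = 1.
  σ⊥τ : Coprime σ τ
  σ⊥τ {i} (i∣σ , i∣τ) = ∣1⇒≡1 (*-cancelʳ-∣ g (subst (i * g ∣_) (sym (*-identityˡ g))
    (IsGCD.greatest isGCD (∣-⟨⟩ λ { (j , x≡sj) →
      subst (i * g ∣_) (sym (ℤ.+-injective (trans x≡sj (s≡t j))))
        (*-monoˡ-∣ g (∣m∣n⇒∣m+n i∣σ (∣m⇒∣m*n (repunit a j) i∣τ))) }))))
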